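{- Let $\mathcal{F}$ be an infinite frieze with quiddity row $(a_i)_{i\in\mathbb{Z}}$ and let $k$ be a fixed integer. Then the sequence $(\hat a_i)_{i\in\mathbb{Z}}$ defined by $$\hat a_i=\begin{cases} a_i&\text{if }i\le k-1,\\ a_k+1&\text{if }i=k,\\ 1&\text{if }i=k+1,\\ a_{k+1}+1&\text{if }i=k+2,\\ a_{i-1}&\text{if }i\ge k+3,\end{cases}$$ is the quiddity row of an infinite frieze $\widehat{\mathcal{F}}$.
   Context: An infinite frieze is an array $(m_{ij})_{i,j\in\mathbb{Z},\,j-i\ge -2}$ of integers with $m_{i,i-2}=0$ and $m_{i,i-1}=1$ for all $i\in\mathbb{Z}$, $m_{ij}>0$ for all $j\ge i$, and $m_{ij}m_{i+1,j+1}-m_{i+1,j}m_{i,j+1}=1$ for all $j-i\ge -1$. Its quiddity row is the sequence $(a_i)_{i\in\mathbb{Z}}$ with $a_i=m_{ii}$. -}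

module Defs where

open import Data.Bool using (if_then_else_)
open import Data.Integer
open import Data.Integer.Properties
open import Data.Integer.Tactic.RingSolver using (solve-∀)
import Data.Nat as ℕ
open import Relation.Binary.PropositionalEquality using (_≡_; refl; sym; subst)
open import Relation.Nullary using (does)

InDomain : ℤ → ℤ → Set
InDomain i j = j - i ≥ - + 2

private
  -2≤-1 : - + 2 ≤ - + 1
  -2≤-1 = -≤- ℕ.z≤n

dom[i,i-2] : ∀ i → InDomain i (i - + 2)
dom[i,i-2] i = ≤-reflexive (sym (eq i))
  where
  eq : ∀ i → i - + 2 - i ≡ - + 2
  eq = solve-∀

dom[i,i-1] : ∀ i → InDomain i (i - + 1)
dom[i,i-1] i = ≤-trans -2≤-1 (≤-reflexive (sym (eq i)))
  where
  eq : ∀ i → i - + 1 - i ≡ - + 1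
  eq = solve-∀

dom-≥ : ∀ i j → j ≥ i → InDomain i j
dom-≥ i j j≥i = ≤-trans -≤+ (i≤j⇒0≤j-i j≥i)

module _ (i j : ℤ) (j-i≥-1 : j - i ≥ - + 1) where

  dom[i,j] : InDomain i j
  dom[i,j] = ≤-trans -2≤-1 j-i≥-1

  dom[i+1,j+1] : InDomain (i + + 1) (j + + 1)
  dom[i+1,j+1] = subst (_≥ - + 2) (eq i j) dom[i,j]
    where
    eq : ∀ i j → j - i ≡ j + + 1 - (i + + 1)
    eq = solve-∀

  dom[i+1,j] : InDomain (i + + 1) j
  dom[i+1,j] = subst (_≥ - + 2) (eq i j) (+-monoˡ-≤ (- + 1) j-i≥-1)
    where
    eq : ∀ i j → j - i + (- + 1) ≡ j - (i + + 1)
    eq = solve-∀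

  dom[i,j+1] : InDomain i (j + + 1)
  dom[i,j+1] = subst (_≥ - + 2) (eq i j) (≤-trans dom[i,j] (i≤i+j (j - i) (+ 1)))
    where
    eq : ∀ i j → j - i + + 1 ≡ j + + 1 - i
    eq = solve-∀

-- The domain proof is an irrelevant argument, so an entry depends on the
-- indices i and j alone.
record InfiniteFrieze : Set where
  field
    m : (i j : ℤ) → .(InDomain i j) → ℤ
    m[i,i-2]≡0 : ∀ i → m i (i - + 2) (dom[i,i-2] i) ≡ + 0
    m[i,i-1]≡1 : ∀ i → m i (i - + 1) (dom[i,i-1] i) ≡ + 1
    m[i,j]>0 : ∀ i j (j≥i : j ≥ i) → m i j (dom-≥ i j j≥i) > + 0
    unimodular : ∀ i j (p : j - i ≥ - + 1) →
      m i j (dom[i,j] i j p) * m (i + + 1) (j + + 1) (dom[i+1,j+1] i j p)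
        - m (i + + 1) j (dom[i+1,j] i j p) * m i (j + + 1) (dom[i,j+1] i j p)
        ≡ + 1

  quiddityRow : ℤ → ℤ
  quiddityRow i = m i i (dom-≥ i i ≤-refl)

-- The conditions are tried in order, so the last branch is reached exactly
-- when i ≥ k + 3.
insertOne : (ℤ → ℤ) → ℤ → (ℤ → ℤ)
insertOne a k i =
  if does (i ≤? k - + 1) then a i
  else if does (i ≟ k) then a k + + 1
  else if does (i ≟ k + + 1) then + 1
  else if does (i ≟ k + + 2) then a (k + + 1) + + 1
  else a (i - + 1)

{-# OPTIONS --safe #-}

-- Write λ(u,v) = m_{u+1,v-1} for the label of the arc from vertex u to vertex v,
-- so that λ(u,u) = 0, λ(u,u+1) = 1 and a_v = λ(v-1,v+1). Extended by
-- λ(v,u) = -λ(u,v), the array satisfies the unimodular rule at all pairs of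
-- integers. Inserting a 1 in the quiddity row is gluing a triangle on the edge
-- (k,k+1): a new vertex is inserted between k and k+1, and its row and column are
-- the sums of those of its two neighbours. The unimodular rule says that 2×2
-- determinants of consecutive entries are 1, and det(x,x+y) = det(x+y,y) = det(x,y).
module Submission where

open import Defs
open import Data.Bool using (if_then_else_)
open import Data.Empty using (⊥-elim)
open import Data.Integer
open import Data.Integer.Properties
open import Data.Integer.Tactic.RingSolver using (solve-∀)
import Data.Nat as ℕ
open import Data.Product using (Σ-syntax; _,_)
open import Relation.Binary.Definitions using (tri<; tri≈; tri>)
open import Relation.Binary.PropositionalEquality
open import Relation.Nullary using (does; yes; no)
open import Relation.Nullary.Decidable using (dec-true; dec-false)

open ≡-Reasoning

-- Order and shifts by one on the integers.

i+1-1≡i : ∀ i → i + + 1 - + 1 ≡ i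
i+1-1≡i = solve-∀

i-1+1≡i : ∀ i → i - + 1 + + 1 ≡ i
i-1+1≡i = solve-∀

i+1≡j+1⇒i≡j : ∀ i j → i + + 1 ≡ j + + 1 → i ≡ j
i+1≡j+1⇒i≡j i j eq = subst₂ _≡_ (i+1-1≡i i) (i+1-1≡i j) (cong (_- + 1) eq)

i<j⇒i+1≤j : ∀ {i j} → i < j → i + + 1 ≤ j
i<j⇒i+1≤j {i} {j} i<j = subst (_≤ j) (+-comm (+ 1) i) (i<j⇒suc[i]≤j i<j)

i+1≤j⇒i<j : ∀ {i j} → i + + 1 ≤ j → i < j
i+1≤j⇒i<j {i} {j} i+1≤j = suc[i]≤j⇒i<j (subst (_≤ j) (+-comm i (+ 1)) i+1≤j)

i<i+1 : ∀ i → i < i + + 1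
i<i+1 i = i+1≤j⇒i<j ≤-refl

i<i+1+1 : ∀ i → i < i + + 1 + + 1
i<i+1+1 i = <-trans (i<i+1 i) (i<i+1 (i + + 1))

i≤j-1⇒i+1≤j : ∀ {i j} → i ≤ j - + 1 → i + + 1 ≤ j
i≤j-1⇒i+1≤j {i} {j} i≤j-1 = subst (i + + 1 ≤_) (i-1+1≡i j) (+-monoˡ-≤ (+ 1) i≤j-1)

i<j+1⇒i≤j : ∀ {i j} → i < j + + 1 → i ≤ j
i<j+1⇒i≤j {i} {j} i<j+1 =
  subst₂ _≤_ (i+1-1≡i i) (i+1-1≡i j) (+-monoˡ-≤ (- + 1) (i<j⇒i+1≤j i<j+1))

i≤j⇒i<j+1 : ∀ {i j} → i ≤ j → i < j + + 1
i≤j⇒i<j+1 i≤j = ≤-<-trans i≤j (i<i+1 _)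

i+1<j+1⇒i<j : ∀ {i j} → i + + 1 < j + + 1 → i < j
i+1<j+1⇒i<j i+1<j+1 = i+1≤j⇒i<j (i<j+1⇒i≤j i+1<j+1)

-- Discrete Wronskians (Casoratians) and arrays of arc labels.

wronskian : (ℤ → ℤ) → (ℤ → ℤ) → ℤ → ℤ
wronskian f g v = f v * g (v + + 1) - g v * f (v + + 1)

record ArcArray : Set where
  field
    arc : ℤ → ℤ → ℤ
    arc[u,u]≡0 : ∀ u → arc u u ≡ + 0
    arc[u,u+1]≡1 : ∀ u → arc u (u + + 1) ≡ + 1
    arc[u,v]>0 : ∀ {u v} → u < v → arc u v > + 0
    arc-unimodular : ∀ u v → wronskian (arc u) (arc (u + + 1)) v ≡ + 1

  arc[u,v]≥0 : ∀ {u v} → u ≤ v → arc u v ≥ + 0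
  arc[u,v]≥0 {u} {v} u≤v with u ≟ v
  ... | yes refl = ≤-reflexive (sym (arc[u,u]≡0 u))
  ... | no u≢v = <⇒≤ (arc[u,v]>0 (≤∧≢⇒< u≤v u≢v))

  -- The rule at `(u, u)` reads `0 * y - x * 1 = 1`. The value is what makes the diagonal entry at
  -- the new vertex vanish.
  arc[u+1,u]≡-1 : ∀ u → arc (u + + 1) u ≡ - + 1
  arc[u+1,u]≡-1 u = begin
    x
      ≡⟨ expand x y ⟩
    - (+ 0 * y - x * + 1)
      ≡⟨ cong₂ (λ a b → - (a * y - x * b)) (arc[u,u]≡0 u) (arc[u,u+1]≡1 u) ⟨
    - wronskian (arc u) (arc (u + + 1)) u
      ≡⟨ cong -_ (arc-unimodular u u) ⟩
    - + 1
      ∎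
    where
    x = arc (u + + 1) u
    y = arc (u + + 1) (u + + 1)
    expand : ∀ x y → x ≡ - (+ 0 * y - x * + 1)
    expand = solve-∀

toFrieze : ArcArray → InfiniteFrieze
toFrieze A = record
  { m = λ i j _ → arc (i - + 1) (j + + 1)
  ; m[i,i-2]≡0 = λ i → trans (cong (arc (i - + 1)) (i-2+1≡i-1 i)) (arc[u,u]≡0 (i - + 1))
  ; m[i,i-1]≡1 = λ i → arc[u,u+1]≡1 (i - + 1)
  ; m[i,j]>0 = λ i j i≤j → arc[u,v]>0 (i≤j⇒i<j+1 (i≤j⇒i-k≤j (+ 1) i≤j))
  ; unimodular = λ i j _ →
      -- The array rule calls the next row `i - 1 + 1`, the frieze rule `i + 1 - 1`.
      subst (λ i′ → arc (i - + 1) (j + + 1) * arc i′ (j + + 1 + + 1)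
                    - arc i′ (j + + 1) * arc (i - + 1) (j + + 1 + + 1) ≡ + 1)
        (i-1+1≡i+1-1 i) (arc-unimodular (i - + 1) (j + + 1))
  }
  where
  open ArcArray A
  i-1+1≡i+1-1 : ∀ i → i - + 1 + + 1 ≡ i + + 1 - + 1
  i-1+1≡i+1-1 = solve-∀
  i-2+1≡i-1 : ∀ i → i - + 2 + + 1 ≡ i - + 1
  i-2+1≡i-1 = solve-∀

-- From a frieze to its skew extension.

module _ (F : InfiniteFrieze) where
  open InfiniteFrieze F

  m-cong : ∀ {i i′ j j′} → i ≡ i′ → j ≡ j′ →
    .(d : InDomain i j) .(d′ : InDomain i′ j′) → m i j d ≡ m i′ j′ d′
  m-cong refl refl _ _ = refl

  arcDomain : ∀ {u v} → u ≤ v → InDomain (u + + 1) (v - + 1)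
  arcDomain {u} {v} u≤v =
    subst (_≥ - + 2) (shift u v) (+-monoˡ-≤ (- + 2) (i≤j⇒0≤j-i u≤v))
    where
    shift : ∀ u v → v - u + - + 2 ≡ v - + 1 - (u + + 1)
    shift = solve-∀

  entry : ∀ u v → .(u ≤ v) → ℤ
  entry u v u≤v = m (u + + 1) (v - + 1) (arcDomain u≤v)

  entry[u,u]≡0 : ∀ u .(u≤u : u ≤ u) → entry u u u≤u ≡ + 0
  entry[u,u]≡0 u u≤u = trans
    (m-cong refl (eq u) (arcDomain u≤u) (dom[i,i-2] (u + + 1))) (m[i,i-2]≡0 (u + + 1))
    where
    eq : ∀ u → u - + 1 ≡ u + + 1 - + 2
    eq = solve-∀

  entry[u,u+1]≡1 : ∀ u .(u≤u+1 : u ≤ u + + 1) → entry u (u + + 1) u≤u+1 ≡ + 1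
  entry[u,u+1]≡1 u u≤u+1 = m[i,i-1]≡1 (u + + 1)

  -- The axiom `m[i,j]>0` starts at `j = i`, which is `v = u + 2`; the gap `v = u + 1` is filled by
  -- the row of ones.
  entry>0 : ∀ {u v} (u<v : u < v) .(u≤v : u ≤ v) → entry u v u≤v > + 0
  entry>0 {u} {v} u<v u≤v with <-cmp (u + + 1) v
  ... | tri< u+1<v _ _ = m[i,j]>0 (u + + 1) (v - + 1)
    (subst (_≤ v - + 1) (i+1-1≡i (u + + 1)) (+-monoˡ-≤ (- + 1) (i<j⇒i+1≤j u+1<v)))
  ... | tri≈ _ refl _ = subst (_> + 0) (sym (entry[u,u+1]≡1 u u≤v)) (+<+ (ℕ.s≤s ℕ.z≤n))
  ... | tri> _ _ v<u+1 = ⊥-elim (≤⇒≯ (i<j+1⇒i≤j v<u+1) u<v)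

  -- With `i = u + 1` and `j = v - 1`, the frieze condition `j - i ≥ -1` becomes `u < v`.
  entry-unimodular : ∀ {u v} (u<v : u < v)
    .(p : u ≤ v) .(q : u + + 1 ≤ v + + 1) .(r : u + + 1 ≤ v) .(s : u ≤ v + + 1) →
    entry u v p * entry (u + + 1) (v + + 1) q
      - entry (u + + 1) v r * entry u (v + + 1) s ≡ + 1
  entry-unimodular {u} {v} u<v p q r s = trans
    (cong₂ (λ x y → entry u v p * x - entry (u + + 1) v r * y)
      (m-cong refl (eq v) (arcDomain q) (dom[i+1,j+1] i j d))
      (m-cong refl (eq v) (arcDomain s) (dom[i,j+1] i j d)))
    (unimodular i j d)
    where
    i = u + + 1
    j = v - + 1
    eq : ∀ v → v + + 1 - + 1 ≡ v - + 1 + + 1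
    eq = solve-∀
    shift : ∀ u v → v - (u + + 1) + - + 1 ≡ v - + 1 - (u + + 1)
    shift = solve-∀
    d : j - i ≥ - + 1
    d = subst (_≥ - + 1) (shift u v) (+-monoˡ-≤ (- + 1) (i≤j⇒0≤j-i (i<j⇒i+1≤j u<v)))

  skewEntry : ℤ → ℤ → ℤ
  skewEntry u v with u ≤? v
  ... | yes u≤v = entry u v u≤v
  ... | no u≰v = - entry v u (<⇒≤ (≰⇒> u≰v))

  skewEntry-≤ : ∀ {u v} (u≤v : u ≤ v) → skewEntry u v ≡ entry u v u≤v
  skewEntry-≤ {u} {v} u≤v with u ≤? v
  ... | yes _ = refl
  ... | no u≰v = ⊥-elim (u≰v u≤v)

  -- On the diagonal `skewEntry` takes its first branch; the two formulas agree there because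
  -- `0 = - 0`.
  skewEntry-≥ : ∀ {u v} (v≤u : v ≤ u) → skewEntry u v ≡ - entry v u v≤u
  skewEntry-≥ {u} {v} v≤u with u ≤? v
  ... | no _ = refl
  ... | yes u≤v with ≤-antisym u≤v v≤u
  ...   | refl = trans (entry[u,u]≡0 u u≤v) (cong -_ (sym (entry[u,u]≡0 u v≤u)))

  skewEntry[u,u]≡0 : ∀ u → skewEntry u u ≡ + 0
  skewEntry[u,u]≡0 u = trans (skewEntry-≤ {u} ≤-refl) (entry[u,u]≡0 u ≤-refl)

  skewEntry[u,u+1]≡1 : ∀ u → skewEntry u (u + + 1) ≡ + 1
  skewEntry[u,u+1]≡1 u = trans (skewEntry-≤ (i≤i+j u (+ 1))) (entry[u,u+1]≡1 u (i≤i+j u (+ 1)))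

  -- Above the diagonal this is the frieze rule. On it, the off-diagonal product is `-1 * 1` and the
  -- other product vanishes. Below it, the signs cancel in pairs and the matrix is the transpose of
  -- the one at `(v, u)`.
  skewEntry-unimodular : ∀ u v → wronskian (skewEntry u) (skewEntry (u + + 1)) v ≡ + 1
  skewEntry-unimodular u v with <-cmp u v
  ... | tri< u<v _ _
      rewrite skewEntry-≤ (<⇒≤ u<v) | skewEntry-≤ (+-monoˡ-≤ (+ 1) (<⇒≤ u<v))
            | skewEntry-≤ (i<j⇒i+1≤j u<v) | skewEntry-≤ (<⇒≤ (i≤j⇒i<j+1 (<⇒≤ u<v)))
    = entry-unimodular u<v (<⇒≤ u<v) (+-monoˡ-≤ (+ 1) (<⇒≤ u<v))
        (i<j⇒i+1≤j u<v) (<⇒≤ (i≤j⇒i<j+1 (<⇒≤ u<v)))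
  ... | tri≈ _ refl _
      rewrite skewEntry[u,u]≡0 u | skewEntry[u,u+1]≡1 u
            | skewEntry-≥ (i≤i+j u (+ 1)) | entry[u,u+1]≡1 u (i≤i+j u (+ 1))
    = refl
  ... | tri> _ _ v<u
      rewrite skewEntry-≥ (<⇒≤ v<u) | skewEntry-≥ (+-monoˡ-≤ (+ 1) (<⇒≤ v<u))
            | skewEntry-≥ (i<j⇒i+1≤j v<u) | skewEntry-≥ (<⇒≤ (i≤j⇒i<j+1 (<⇒≤ v<u)))
    = trans
        (transpose (entry v u p) (entry (v + + 1) (u + + 1) q)
          (entry v (u + + 1) s) (entry (v + + 1) u r))
        (entry-unimodular v<u p q r s)
    where
    p = <⇒≤ v<u
    q = +-monoˡ-≤ (+ 1) (<⇒≤ v<u)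
    r = i<j⇒i+1≤j v<u
    s = <⇒≤ (i≤j⇒i<j+1 (<⇒≤ v<u))
    transpose : ∀ x y z w → - x * - y - - z * - w ≡ x * y - w * z
    transpose = solve-∀

  arcArray : ArcArray
  arcArray = record
    { arc = skewEntry
    ; arc[u,u]≡0 = skewEntry[u,u]≡0
    ; arc[u,u+1]≡1 = skewEntry[u,u+1]≡1
    ; arc[u,v]>0 = λ u<v →
        subst (_> + 0) (sym (skewEntry-≤ (<⇒≤ u<v))) (entry>0 u<v (<⇒≤ u<v))
    ; arc-unimodular = skewEntry-unimodular
    }

  arcArray-quiddity : ∀ u → skewEntry u (u + + 1 + + 1) ≡ quiddityRow (u + + 1)
  arcArray-quiddity u = trans (skewEntry-≤ u≤u+2)
    (m-cong refl (i+1-1≡i (u + + 1)) (arcDomain u≤u+2) (dom-≥ (u + + 1) (u + + 1) ≤-refl))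
    where
    u≤u+2 : u ≤ u + + 1 + + 1
    u≤u+2 = <⇒≤ (i<i+1+1 u)

-- Inserting the sum of two consecutive terms between them.

module _ (k : ℤ) where

  -- The new vertex takes the label `k + 1`, so each old vertex beyond `k` moves up by one.
  insertSum : (ℤ → ℤ) → ℤ → ℤ
  insertSum f u =
    if does (u ≤? k) then f u
    else if does (u ≟ k + + 1) then f k + f (k + + 1)
    else f (u - + 1)

  insertSum-left : ∀ f {u} → u ≤ k → insertSum f u ≡ f u
  insertSum-left f {u} u≤k rewrite dec-true (u ≤? k) u≤k = refl

  insertSum-new : ∀ f → insertSum f (k + + 1) ≡ f k + f (k + + 1)
  insertSum-new f
    rewrite dec-false (k + + 1 ≤? k) (<⇒≱ (i<i+1 k))
          | dec-true (k + + 1 ≟ k + + 1) refl = refl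

  insertSum-right : ∀ f {u} → k < u → insertSum f (u + + 1) ≡ f u
  insertSum-right f {u} k<u
    rewrite dec-false (u + + 1 ≤? k) (<⇒≱ (<-trans k<u (i<i+1 u)))
          | dec-false (u + + 1 ≟ k + + 1) (≢-sym (<⇒≢ (+-monoˡ-< (+ 1) k<u)))
    = cong f (i+1-1≡i u)

  -- `right` carries the old label of a shifted vertex, so that matching on it gives the index the
  -- form `insertSum-right` rewrites.
  data Position : ℤ → Set where
    left  : ∀ {u} → u ≤ k → Position u
    new   : Position (k + + 1)
    right : ∀ {u} → k < u → Position (u + + 1)

  position : ∀ u → Position u
  position u with u ≤? k | u ≟ k + + 1
  ... | yes u≤k | _ = left u≤k
  ... | no _ | yes refl = new
  ... | no u≰k | no u≢k+1 = subst Position (i-1+1≡i u) (right k<u-1)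
    where
    k+1<u : k + + 1 < u
    k+1<u = ≤∧≢⇒< (i<j⇒i+1≤j (≰⇒> u≰k)) (≢-sym u≢k+1)
    k<u-1 : k < u - + 1
    k<u-1 = i+1<j+1⇒i<j (subst (k + + 1 <_) (sym (i-1+1≡i u)) k+1<u)

  -- Classifies the pair `u`, `u + 1`; it contains the new vertex exactly in the cases `before` and
  -- `after`.
  data Consecutive : ℤ → Set where
    below  : ∀ {u} → u < k → Consecutive u
    before : Consecutive k
    after  : Consecutive (k + + 1)
    above  : ∀ {u} → k < u → Consecutive (u + + 1)

  consecutive : ∀ u → Consecutive u
  consecutive u with position u
  ... | new = after
  ... | right k<u = above k<u
  ... | left u≤k with u ≟ k
  ...   | yes refl = before
  ...   | no u≢k = below (≤∧≢⇒< u≤k u≢k)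

  -- Pairs that avoid the new vertex are old consecutive pairs. For the two that contain it, a
  -- column operation leads back to the old determinant at `k`.
  wronskian-insertSum : ∀ f g → (∀ v → wronskian f g v ≡ + 1) →
    ∀ v → wronskian (insertSum f) (insertSum g) v ≡ + 1
  wronskian-insertSum f g W≡1 v with consecutive v
  ... | below v<k
      rewrite insertSum-left f (<⇒≤ v<k) | insertSum-left f (i<j⇒i+1≤j v<k)
            | insertSum-left g (<⇒≤ v<k) | insertSum-left g (i<j⇒i+1≤j v<k)
    = W≡1 v
  ... | before
      rewrite insertSum-left f (≤-refl {k}) | insertSum-new f
            | insertSum-left g (≤-refl {k}) | insertSum-new g
    = trans (add (f k) (f (k + + 1)) (g k) (g (k + + 1))) (W≡1 k)
    where
    add : ∀ a b c d → a * (c + d) - c * (a + b) ≡ a * d - c * b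
    add = solve-∀
  ... | after
      rewrite insertSum-right f (i<i+1 k) | insertSum-new f
            | insertSum-right g (i<i+1 k) | insertSum-new g
    = trans (add (f k) (f (k + + 1)) (g k) (g (k + + 1))) (W≡1 k)
    where
    add : ∀ a b c d → (a + b) * d - (c + d) * b ≡ a * d - c * b
    add = solve-∀
  ... | above {u} k<u
      rewrite insertSum-right f k<u | insertSum-right f (<-trans k<u (i<i+1 u))
            | insertSum-right g k<u | insertSum-right g (<-trans k<u (i<i+1 u))
    = W≡1 u

  -- Gluing a triangle to an arc array.

  module _ (A : ArcArray) where
    open ArcArray A

    -- The halfway stage: rows carry old labels, columns new ones. Treating one index at a time lets
    -- `wronskian-insertSum` serve for both.
    insertedRow : ℤ → ℤ → ℤ
    insertedRow u = insertSum (arc u)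

    insertedArc : ℤ → ℤ → ℤ
    insertedArc u v = insertSum (λ u′ → insertedRow u′ v) u

    insertedArc-left : ∀ {u} v → u ≤ k → insertedArc u v ≡ insertedRow u v
    insertedArc-left v = insertSum-left (λ u → insertedRow u v)

    insertedArc-new : ∀ v → insertedArc (k + + 1) v ≡ insertedRow k v + insertedRow (k + + 1) v
    insertedArc-new v = insertSum-new (λ u → insertedRow u v)

    insertedArc-right : ∀ {u} v → k < u → insertedArc (u + + 1) v ≡ insertedRow u v
    insertedArc-right v = insertSum-right (λ u → insertedRow u v)

    insertedArc[u,u]≡0 : ∀ u → insertedArc u u ≡ + 0
    insertedArc[u,u]≡0 u with position u
    ... | left u≤k
        rewrite insertedArc-left u u≤k | insertSum-left (arc u) u≤k = arc[u,u]≡0 u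
    -- The four old entries around the edge add up to `(0 + 1) + (-1 + 0)`.
    ... | new
        rewrite insertedArc-new (k + + 1) | insertSum-new (arc k) | insertSum-new (arc (k + + 1))
              | arc[u,u]≡0 k | arc[u,u+1]≡1 k | arc[u+1,u]≡-1 k | arc[u,u]≡0 (k + + 1) = refl
    ... | right {w} k<w
        rewrite insertedArc-right (w + + 1) k<w | insertSum-right (arc w) k<w = arc[u,u]≡0 w

    insertedArc[u,u+1]≡1 : ∀ u → insertedArc u (u + + 1) ≡ + 1
    insertedArc[u,u+1]≡1 u with consecutive u
    ... | below u<k
        rewrite insertedArc-left (u + + 1) (<⇒≤ u<k) | insertSum-left (arc u) (i<j⇒i+1≤j u<k)
      = arc[u,u+1]≡1 u
    ... | before
        rewrite insertedArc-left (k + + 1) ≤-refl | insertSum-new (arc k)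
              | arc[u,u]≡0 k | arc[u,u+1]≡1 k = refl
    ... | after
        rewrite insertedArc-new (k + + 1 + + 1) | insertSum-right (arc k) (i<i+1 k)
              | insertSum-right (arc (k + + 1)) (i<i+1 k)
              | arc[u,u]≡0 (k + + 1) | arc[u,u+1]≡1 k = refl
    ... | above {w} k<w
        rewrite insertedArc-right (w + + 1 + + 1) k<w
              | insertSum-right (arc w) (<-trans k<w (i<i+1 w)) = arc[u,u+1]≡1 w

    insertedArc>0 : ∀ {u v} → u < v → insertedArc u v > + 0
    insertedArc>0 {u} {v} u<v with position u | position v
    ... | left u≤k | left v≤k
        rewrite insertedArc-left v u≤k | insertSum-left (arc u) v≤k = arc[u,v]>0 u<v
    -- The summand ending at `k` is zero when `u = k`; strictness comes from the one ending at
    -- `k + 1`.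
    ... | left u≤k | new
        rewrite insertedArc-left (k + + 1) u≤k | insertSum-new (arc u)
      = +-mono-≤-< (arc[u,v]≥0 u≤k) (arc[u,v]>0 (i≤j⇒i<j+1 u≤k))
    ... | left u≤k | right {w} k<w
        rewrite insertedArc-left (w + + 1) u≤k | insertSum-right (arc u) k<w
      = arc[u,v]>0 (≤-<-trans u≤k k<w)
    ... | new | left v≤k = ⊥-elim (≤⇒≯ v≤k (<-trans (i<i+1 k) u<v))
    ... | new | new = ⊥-elim (<-irrefl refl u<v)
    -- Here the summand starting at `k + 1` is zero when `w = k + 1`, and the one starting at `k` is
    -- positive.
    ... | new | right {w} k<w
        rewrite insertedArc-new (w + + 1) | insertSum-right (arc k) k<w
              | insertSum-right (arc (k + + 1)) k<w
      = +-mono-<-≤ (arc[u,v]>0 k<w) (arc[u,v]≥0 (i<j⇒i+1≤j k<w))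
    ... | right {w} k<w | left v≤k =
      ⊥-elim (≤⇒≯ v≤k (<-trans k<w (<-trans (i<i+1 w) u<v)))
    ... | right k<w | new = ⊥-elim (<-asym k<w (i+1<j+1⇒i<j u<v))
    ... | right {u′} k<u′ | right {v′} k<v′
        rewrite insertedArc-right (v′ + + 1) k<u′ | insertSum-right (arc u′) k<v′
      = arc[u,v]>0 (i+1<j+1⇒i<j u<v)

    -- Columns are inserted for two consecutive old rows; transposing turns the result into a
    -- statement about two consecutive columns, into which rows are inserted, and a second
    -- transposition restores the order.
    insertedArc-unimodular : ∀ u v →
      wronskian (insertedArc u) (insertedArc (u + + 1)) v ≡ + 1
    insertedArc-unimodular u v = trans
      (transpose (insertedArc u v) (insertedArc (u + + 1) (v + + 1))
        (insertedArc (u + + 1) v) (insertedArc u (v + + 1)))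
      (wronskian-insertSum (λ u → insertedRow u v) (λ u → insertedRow u (v + + 1)) columns u)
      where
      transpose : ∀ a b c d → a * b - c * d ≡ a * b - d * c
      transpose = solve-∀
      columns : ∀ u → wronskian (λ u → insertedRow u v) (λ u → insertedRow u (v + + 1)) u ≡ + 1
      columns u = trans
        (transpose (insertedRow u v) (insertedRow (u + + 1) (v + + 1))
          (insertedRow u (v + + 1)) (insertedRow (u + + 1) v))
        (wronskian-insertSum (arc u) (arc (u + + 1)) (arc-unimodular u) v)

    insertVertex : ArcArray
    insertVertex = record
      { arc = insertedArc
      ; arc[u,u]≡0 = insertedArc[u,u]≡0
      ; arc[u,u+1]≡1 = insertedArc[u,u+1]≡1
      ; arc[u,v]>0 = insertedArc>0
      ; arc-unimodular = insertedArc-unimodular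
      }

    -- The case split repeats the tests of `insertOne`, so that its conditionals reduce.
    insertVertex-quiddity : ∀ a → (∀ u → arc u (u + + 1 + + 1) ≡ a (u + + 1)) →
      ∀ u → insertedArc u (u + + 1 + + 1) ≡ insertOne a k (u + + 1)
    insertVertex-quiddity a q u
      with u + + 1 ≤? k - + 1 | u + + 1 ≟ k | u + + 1 ≟ k + + 1 | u + + 1 ≟ k + + 2
    ... | yes u+1≤k-1 | _ | _ | _ with i≤j-1⇒i+1≤j u+1≤k-1
    ...   | u+2≤k
        rewrite insertedArc-left (u + + 1 + + 1) (<⇒≤ (<-≤-trans (i<i+1+1 u) u+2≤k))
              | insertSum-left (arc u) u+2≤k
      = q u
    -- The arc ends at the new vertex: an edge plus the old arc around `k`.
    insertVertex-quiddity a q u | no _ | yes refl | _ | _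
        rewrite insertedArc-left (u + + 1 + + 1) (i≤i+j u (+ 1)) | insertSum-new (arc u)
              | arc[u,u+1]≡1 u
      = trans (cong (_+_ (+ 1)) (q u)) (+-comm (+ 1) (a (u + + 1)))
    -- The arc around the new vertex is the old edge from `k` to `k + 1`.
    insertVertex-quiddity a q u | no _ | no _ | yes u+1≡k+1 | _
        with i+1≡j+1⇒i≡j u k u+1≡k+1
    ...   | refl
        rewrite insertedArc-left (k + + 1 + + 1) ≤-refl | insertSum-right (arc k) (i<i+1 k)
      = arc[u,u+1]≡1 k
    -- The arc starts at the new vertex: the old arc around `k + 1` plus an edge.
    insertVertex-quiddity a q u | no _ | no _ | no _ | yes u+1≡k+2
        with i+1≡j+1⇒i≡j u (k + + 1) (trans u+1≡k+2 (sym (+-assoc k (+ 1) (+ 1))))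
    ...   | refl
        rewrite insertedArc-new (k + + 1 + + 1 + + 1)
              | insertSum-right (arc k) (i<i+1+1 k)
              | insertSum-right (arc (k + + 1)) (i<i+1+1 k)
      = cong₂ _+_ (q k) (arc[u,u+1]≡1 (k + + 1))
    insertVertex-quiddity a q u | no u+1≰k-1 | no u+1≢k | no u+1≢k+1 | no u+1≢k+2
        with consecutive u
    -- The failed tests leave only `above`, where the arc is an old one shifted by one.
    ... | below u<k = ⊥-elim (u+1≰k-1 (i<j+1⇒i≤j
      (subst (u + + 1 <_) (sym (i-1+1≡i k)) (≤∧≢⇒< (i<j⇒i+1≤j u<k) u+1≢k))))
    ... | before = ⊥-elim (u+1≢k+1 refl)
    ... | after = ⊥-elim (u+1≢k+2 (+-assoc k (+ 1) (+ 1)))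
    ... | above {w} k<w
        rewrite insertedArc-right (w + + 1 + + 1 + + 1) k<w
              | insertSum-right (arc w) (<-trans k<w (i<i+1+1 w))
      = trans (q w) (cong a (sym (i+1-1≡i (w + + 1))))

theorem2p1 : (F : InfiniteFrieze) (k : ℤ) →
    Σ[ F̂ ∈ InfiniteFrieze ]
    InfiniteFrieze.quiddityRow F̂ ≗ insertOne (InfiniteFrieze.quiddityRow F) k
theorem2p1 F k = toFrieze B , quiddity
  where
  B = insertVertex k (arcArray F)
  open ArcArray B
  quiddity : ∀ i → arc (i - + 1) (i + + 1) ≡ insertOne (InfiniteFrieze.quiddityRow F) k i
  quiddity i = subst
    (λ i′ → arc (i - + 1) (i′ + + 1) ≡ insertOne (InfiniteFrieze.quiddityRow F) k i′)
    (i-1+1≡i i)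
    (insertVertex-quiddity k (arcArray F) (InfiniteFrieze.quiddityRow F)
      (arcArray-quiddity F) (i - + 1))
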